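{- For a positive integer $n \equiv 0 \pmod 4$, let $F_1, F_2, F_3$ be graphs on a common set of $n$ vertices, each of which is isomorphic to the vertex-disjoint union of $n/4$ copies of the $4$-cycle $C_4$. Then $\gamma_{\rm sd}(F_1,F_2,F_3) \le 3n/4$.
   Context: All graphs are finite and simple. Given graphs $F_1,F_2,F_3$ (called factors; not necessarily edge-disjoint) with common vertex set $V$, a set $S \subseteq V$ is a simultaneous dominating set if for every $i \in \{1,2,3\}$ every vertex not in $S$ is adjacent in $F_i$ to some vertex of $S$. The simultaneous domination number $\gamma_{\rm sd}(F_1,F_2,F_3)$ is the minimum cardinality of a simultaneous dominating set. -}

module Defs where

open import Data.Fin using (Fin; zero; suc; toℕ)
open import Data.Fin.Properties using (all?; any?)
open import Data.Fin.Subset using (Subset; _∈_; _∉_; ∣_∣; ⊤)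
open import Data.Fin.Subset.Properties using (_∈?_; anySubset?; ∈⊤)
open import Data.Nat using (ℕ; zero; suc; _≤_; z≤n; s≤s; _≟_)
open import Data.Nat.DivMod using (_%_)
open import Data.Product using (∃; _×_; _,_; proj₁; proj₂)
open import Data.Sum using (_⊎_; inj₁; inj₂; swap)
open import Function using (_↔_; _⇔_; Inverse)
open import Relation.Binary using (Decidable; Symmetric; Irreflexive)
open import Relation.Binary.PropositionalEquality using (_≡_; refl; sym)
open import Relation.Nullary using (yes; no; contradiction; ¬?; _×-dec_; _⊎-dec_; _→-dec_)
import Data.Fin as Fin using (_≟_)
import Relation.Unary as U using (Decidable)

-- Decidable adjacency makes γsd below a computable number; finiteness comes from
-- the choice of V.
record Graph (V : Set) : Set₁ where
  field
    Adj    : V → V → Set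
    symm   : Symmetric Adj
    irrefl : Irreflexive _≡_ Adj
    adj?   : Decidable Adj

open Graph public

record _≅_ {V W : Set} (G : Graph V) (H : Graph W) : Set where
  field
    bijection : V ↔ W
  open Inverse bijection public using (to; from)
  field
    preserves : ∀ u v → Adj G u v ⇔ Adj H (to u) (to v)

infix 4 _≅_

C₄ : Graph (Fin 4)
C₄ .Adj u v = (toℕ v ≡ suc (toℕ u) % 4) ⊎ (toℕ u ≡ suc (toℕ v) % 4)
C₄ .symm    = swap
C₄ .irrefl {zero}                 refl (inj₁ ())
C₄ .irrefl {zero}                 refl (inj₂ ())
C₄ .irrefl {suc zero}             refl (inj₁ ())
C₄ .irrefl {suc zero}             refl (inj₂ ())
C₄ .irrefl {suc (suc zero)}       refl (inj₁ ())
C₄ .irrefl {suc (suc zero)}       refl (inj₂ ())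
C₄ .irrefl {suc (suc (suc zero))} refl (inj₁ ())
C₄ .irrefl {suc (suc (suc zero))} refl (inj₂ ())
C₄ .adj? u v = (toℕ v ≟ suc (toℕ u) % 4) ⊎-dec (toℕ u ≟ suc (toℕ v) % 4)

copies : ∀ {V} (m : ℕ) → Graph V → Graph (Fin m × V)
copies m G .Adj (i , u) (j , v)  = i ≡ j × Adj G u v
copies m G .symm (p , a)         = sym p , symm G a
copies m G .irrefl refl (_ , a)  = irrefl G refl a
copies m G .adj? (i , u) (j , v) = (i Fin.≟ j) ×-dec adj? G u v

SimultaneouslyDominates : ∀ {k n} → (Fin k → Graph (Fin n)) → Subset n → Set
SimultaneouslyDominates F S =
  ∀ i v → v ∉ S → ∃ λ u → u ∈ S × Adj (F i) v u

simultaneouslyDominates? : ∀ {k n} (F : Fin k → Graph (Fin n)) →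
                           U.Decidable (SimultaneouslyDominates F)
simultaneouslyDominates? F S =
  all? λ i → all? λ v → ¬? (v ∈? S) →-dec any? λ u → (u ∈? S) ×-dec adj? (F i) v u

IsMinimum : (ℕ → Set) → ℕ → Set
IsMinimum P k = P k × (∀ j → P j → k ≤ j)

minimum : ∀ {P : ℕ → Set} → U.Decidable P → ∀ k → P k → ∃ (IsMinimum P)
minimum P? zero    p = zero , p , λ _ _ → z≤n
minimum P? (suc k) p with P? zero
... | yes p₀ = zero , p₀ , λ _ _ → z≤n
... | no ¬p₀ with minimum (λ j → P? (suc j)) k p
...   | m , pₘ , least = suc m , pₘ , λ where
        zero    p₀ → contradiction p₀ ¬p₀
        (suc j) pⱼ → s≤s (least j pⱼ)

SDCardinality : ∀ {k n} → (Fin k → Graph (Fin n)) → ℕ → Set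
SDCardinality F c = ∃ λ S → SimultaneouslyDominates F S × ∣ S ∣ ≡ c

sdNumber : ∀ {k n} (F : Fin k → Graph (Fin n)) → ∃ (IsMinimum (SDCardinality F))
sdNumber {n = n} F = minimum
  (λ c → anySubset? λ S → simultaneouslyDominates? F S ×-dec (∣ S ∣ ≟ c))
  ∣ ⊤ {n} ∣
  (⊤ {n} , (λ _ _ v∉⊤ → contradiction ∈⊤ v∉⊤) , refl)

γsd : ∀ {k n} → (Fin k → Graph (Fin n)) → ℕ
γsd F = proj₁ (sdNumber F)

{-# OPTIONS --safe #-}
module Submission where

-- Let S be a minimum simultaneous dominating set.  For each s ∈ S some factor blocks the
-- removal of s: in the 4-cycle of that factor through s, either the vertex opposite to s
-- lies outside S, or both neighbours of s do.  Charge s to the opposite vertex in the first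
-- case and to its successor along the cycle in the second.  Within one factor distinct
-- vertices of S are charged to distinct vertices outside S, so |S| ≤ 3 (n − |S|).

open import Data.Nat using (ℕ; zero; suc; _+_; _∸_; _<_; _≤_; _*_; z≤n; s≤s)
open import Data.Nat.DivMod using (_/_; _%_; m*n/n≡m; /-monoˡ-≤)
open import Data.Nat.Properties using (module ≤-Reasoning; <⇒≱; ≤-trans; ≤-reflexive; *-comm; *-distribˡ-+; +-monoˡ-≤; m∸n+n≡m)
open import Data.Fin using (Fin; zero; suc; combine; remQuot)
open import Data.Fin.Properties using (suc-injective; remQuot-combine)
open import Data.Fin.Subset using (Subset; inside; outside; _∈_; _∉_; _-_; ∁; ∣_∣)
open import Data.Fin.Subset.Properties using (_∈?_; x∈p∧x≢y⇒x∈p-y; x∈p⇒∣p-x∣<∣p∣; x∉p⇒x∈∁p; ∣∁p∣≡n∸∣p∣; ∣p∣≤n)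
open import Data.Product using (∃; _×_; _,_; proj₂)
open import Data.Sum using (_⊎_; inj₁; inj₂)
open import Data.Vec using (_∷_; []; _++_; concat; replicate; here; there)
open import Data.Vec.Properties using (lookup-++ˡ; lookup-++ʳ; []=⇒lookup; lookup⇒[]=)
open import Function using (_∘_; Inverse; Equivalence)
open import Relation.Binary.PropositionalEquality using (_≡_; _≢_; refl; sym; trans; cong; subst)
open import Relation.Nullary using (yes; no; contradiction)
import Data.Fin as Fin using (_≟_)
open import Defs

private
  variable
    k m n : ℕ
    V W : Set

-- Induction on `p`: the partner `t₀` of the first member is deleted from `q`, and injectivity
-- ensures that no later member needs it.
∣p∣≤∣q∣-by-matching : (R : Fin n → Fin m → Set) (p : Subset n) (q : Subset m) →
  (∀ {s} → s ∈ p → ∃ λ t → t ∈ q × R s t) →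
  (∀ {s s′ t} → s ∈ p → s′ ∈ p → R s t → R s′ t → s ≡ s′) →
  ∣ p ∣ ≤ ∣ q ∣
∣p∣≤∣q∣-by-matching R [] q match inj = z≤n
∣p∣≤∣q∣-by-matching R (outside ∷ p) q match inj =
  ∣p∣≤∣q∣-by-matching (R ∘ suc) p q (λ s∈p → match (there s∈p))
    λ s∈p s′∈p r r′ → suc-injective (inj (there s∈p) (there s′∈p) r r′)
∣p∣≤∣q∣-by-matching R (inside ∷ p) q match inj with match here
... | t₀ , t₀∈q , r₀ = ≤-trans
  (s≤s (∣p∣≤∣q∣-by-matching (R ∘ suc) p (q - t₀) match′
    λ s∈p s′∈p r r′ → suc-injective (inj (there s∈p) (there s′∈p) r r′)))
  (x∈p⇒∣p-x∣<∣p∣ t₀∈q)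
  where
  match′ : ∀ {s} → s ∈ p → ∃ λ t → t ∈ q - t₀ × R (suc s) t
  match′ s∈p with match (there s∈p)
  ... | t , t∈q , r = t , x∈p∧x≢y⇒x∈p-y t∈q t≢t₀ , r
    where
    t≢t₀ : t ≢ t₀
    -- A shared partner would identify `zero` with a successor.
    t≢t₀ refl with () ← inj here (there s∈p) r₀ r

∣p++q∣≡∣p∣+∣q∣ : (p : Subset m) (q : Subset n) → ∣ p ++ q ∣ ≡ ∣ p ∣ + ∣ q ∣
∣p++q∣≡∣p∣+∣q∣ []            q = refl
∣p++q∣≡∣p∣+∣q∣ (inside  ∷ p) q = cong suc (∣p++q∣≡∣p∣+∣q∣ p q)
∣p++q∣≡∣p∣+∣q∣ (outside ∷ p) q = ∣p++q∣≡∣p∣+∣q∣ p q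

∣concat-replicate∣ : ∀ k (q : Subset n) → ∣ concat (replicate k q) ∣ ≡ k * ∣ q ∣
∣concat-replicate∣ zero    q = refl
∣concat-replicate∣ (suc k) q =
  trans (∣p++q∣≡∣p∣+∣q∣ q (concat (replicate k q))) (cong (∣ q ∣ +_) (∣concat-replicate∣ k q))

combine-∈-concat-replicate : (i : Fin k) {t : Fin n} {q : Subset n} →
                             t ∈ q → combine i t ∈ concat (replicate k q)
combine-∈-concat-replicate {suc k} zero {t} {q} t∈q =
  lookup⇒[]= _ _ (trans (lookup-++ˡ q (concat (replicate k q)) t) ([]=⇒lookup t∈q))
combine-∈-concat-replicate {suc k} (suc i) {t} {q} t∈q =
  lookup⇒[]= _ _ (trans (lookup-++ʳ q (concat (replicate k q)) (combine i t))
                        ([]=⇒lookup (combine-∈-concat-replicate i t∈q)))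

-- Take `k` disjoint copies of `q`, laid end to end in `Fin (k * m)`, and send an element matched
-- through `R i` into the `i`-th copy. Elements using different relations then cannot collide, so a
-- single matching results.
∣p∣≤k*∣q∣-by-matchings : (R : Fin k → Fin n → Fin m → Set) (p : Subset n) (q : Subset m) →
  (∀ {s} → s ∈ p → ∃ λ i → ∃ λ t → t ∈ q × R i s t) →
  (∀ i {s s′ t} → s ∈ p → s′ ∈ p → R i s t → R i s′ t → s ≡ s′) →
  ∣ p ∣ ≤ k * ∣ q ∣
∣p∣≤k*∣q∣-by-matchings {k} {n} {m} R p q match inj = ≤-trans
  (∣p∣≤∣q∣-by-matching R′ p (concat (replicate k q)) match′
    -- A common position decodes to a common index `i`, so injectivity within that one relation
    -- suffices.
    λ s∈p s′∈p → inj _ s∈p s′∈p)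
  (≤-reflexive (∣concat-replicate∣ k q))
  where
  Rel : Fin n → Fin k × Fin m → Set
  Rel s (i , t) = R i s t

  R′ : Fin n → Fin (k * m) → Set
  R′ s j = Rel s (remQuot m j)

  match′ : ∀ {s} → s ∈ p → ∃ λ j → j ∈ concat (replicate k q) × R′ s j
  match′ {s} s∈p with match s∈p
  ... | i , t , t∈q , r = combine i t , combine-∈-concat-replicate i t∈q ,
                          subst (Rel s) (sym (remQuot-combine i t)) r

-- A consistent orientation of all cycles of a disjoint union of 4-cycles.
record Rotation (G : Graph V) : Set where
  field
    next : V → V

  opposite : V → V
  opposite v = next (next v)

  field
    opposite-involutive : ∀ v → opposite (opposite v) ≡ v
    opposite-≢          : ∀ v → opposite v ≢ v
    adj-next            : ∀ v → Adj G v (next v)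
    adj-opposite        : ∀ {v u} → Adj G v u → Adj G v (opposite u)

  -- Since `next` has period four, its third iterate is its inverse. Written as an opposite, its
  -- adjacency to `v` comes from `adj-opposite`.
  prev : V → V
  prev v = opposite (next v)

  adj-prev : ∀ v → Adj G v (prev v)
  adj-prev v = adj-opposite (adj-next v)

  next-injective : ∀ {u v} → next u ≡ next v → u ≡ v
  next-injective {u} {v} eq = trans (sym (opposite-involutive u))
    (trans (cong (opposite ∘ next) eq) (opposite-involutive v))

C₄-rotation : Rotation C₄
C₄-rotation = record
  { next                = next
  ; opposite-involutive = involutive
  ; opposite-≢          = ≢
  ; adj-next            = adj
  ; adj-opposite        = λ {v} {u} → adj-opposite v u
  }
  where
  next : Fin 4 → Fin 4
  next zero                   = suc zero
  next (suc zero)             = suc (suc zero)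
  next (suc (suc zero))       = suc (suc (suc zero))
  next (suc (suc (suc zero))) = zero

  involutive : ∀ v → next (next (next (next v))) ≡ v
  involutive zero                   = refl
  involutive (suc zero)             = refl
  involutive (suc (suc zero))       = refl
  involutive (suc (suc (suc zero))) = refl

  ≢ : ∀ v → next (next v) ≢ v
  ≢ zero                   ()
  ≢ (suc zero)             ()
  ≢ (suc (suc zero))       ()
  ≢ (suc (suc (suc zero))) ()

  adj : ∀ v → Adj C₄ v (next v)
  adj zero                   = inj₁ refl
  adj (suc zero)             = inj₁ refl
  adj (suc (suc zero))       = inj₁ refl
  adj (suc (suc (suc zero))) = inj₁ refl

  adj-opposite : ∀ v u → Adj C₄ v u → Adj C₄ v (next (next u))
  -- First the eight ordered adjacent pairs: the opposite of one neighbour is the other neighbour.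
  adj-opposite zero                   (suc zero)             _ = inj₂ refl
  adj-opposite zero                   (suc (suc (suc zero))) _ = inj₁ refl
  adj-opposite (suc zero)             zero                   _ = inj₁ refl
  adj-opposite (suc zero)             (suc (suc zero))       _ = inj₂ refl
  adj-opposite (suc (suc zero))       (suc zero)             _ = inj₁ refl
  adj-opposite (suc (suc zero))       (suc (suc (suc zero))) _ = inj₂ refl
  adj-opposite (suc (suc (suc zero))) zero                   _ = inj₂ refl
  adj-opposite (suc (suc (suc zero))) (suc (suc zero))       _ = inj₁ refl
  -- The remaining pairs are equal or opposite, hence not adjacent.
  adj-opposite zero                   zero                   (inj₁ ())
  adj-opposite zero                   zero                   (inj₂ ())
  adj-opposite zero                   (suc (suc zero))       (inj₁ ())
  adj-opposite zero                   (suc (suc zero))       (inj₂ ())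
  adj-opposite (suc zero)             (suc zero)             (inj₁ ())
  adj-opposite (suc zero)             (suc zero)             (inj₂ ())
  adj-opposite (suc zero)             (suc (suc (suc zero))) (inj₁ ())
  adj-opposite (suc zero)             (suc (suc (suc zero))) (inj₂ ())
  adj-opposite (suc (suc zero))       zero                   (inj₁ ())
  adj-opposite (suc (suc zero))       zero                   (inj₂ ())
  adj-opposite (suc (suc zero))       (suc (suc zero))       (inj₁ ())
  adj-opposite (suc (suc zero))       (suc (suc zero))       (inj₂ ())
  adj-opposite (suc (suc (suc zero))) (suc zero)             (inj₁ ())
  adj-opposite (suc (suc (suc zero))) (suc zero)             (inj₂ ())
  adj-opposite (suc (suc (suc zero))) (suc (suc (suc zero))) (inj₁ ())
  adj-opposite (suc (suc (suc zero))) (suc (suc (suc zero))) (inj₂ ())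

copies-rotation : {G : Graph V} → Rotation G → Rotation (copies m G)
copies-rotation ρ = record
  { next                = λ (i , v) → i , next v
  ; opposite-involutive = λ (i , v) → cong (i ,_) (opposite-involutive v)
  ; opposite-≢          = λ (i , v) eq → opposite-≢ v (cong proj₂ eq)
  ; adj-next            = λ (i , v) → refl , adj-next v
  ; adj-opposite        = λ (i≡j , a) → i≡j , adj-opposite a
  }
  where open Rotation ρ

-- The rotation of `H` is conjugated by the bijection. Each law is checked after applying `to`,
-- where it becomes the law in `H`.
≅-rotation : {G : Graph V} {H : Graph W} → G ≅ H → Rotation H → Rotation G
≅-rotation {V} {G = G} {H} φ ρ = record
  { next                = next′
  ; opposite-involutive = λ v → from-≡ (trans (to-opposite (next′ (next′ v)))
                                   (trans (cong opposite (to-opposite v)) (opposite-involutive (to v))))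
  ; opposite-≢          = λ v eq → opposite-≢ (to v) (trans (sym (to-opposite v)) (cong to eq))
  ; adj-next            = λ v → Equivalence.from (preserves v (next′ v))
                                  (subst (Adj H (to v)) (sym (to-next v)) (adj-next (to v)))
  ; adj-opposite        = λ {v} {u} a → Equivalence.from (preserves v (next′ (next′ u)))
                                  (subst (Adj H (to v)) (sym (to-opposite u))
                                    (adj-opposite (Equivalence.to (preserves v u) a)))
  }
  where
  open Rotation ρ
  open _≅_ φ
  open Inverse bijection using (strictlyInverseˡ; strictlyInverseʳ)

  next′ : V → V
  next′ v = from (next (to v))

  to-next : ∀ v → to (next′ v) ≡ next (to v)
  to-next v = strictlyInverseˡ (next (to v))

  to-opposite : ∀ v → to (next′ (next′ v)) ≡ opposite (to v)
  to-opposite v = trans (to-next (next′ v)) (cong next (to-next v))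

  from-≡ : ∀ {u v} → to u ≡ to v → u ≡ v
  from-≡ {u} {v} eq =
    trans (sym (strictlyInverseʳ u)) (trans (cong from eq) (strictlyInverseʳ v))

module _ {G : Graph (Fin n)} (ρ : Rotation G) (S : Subset n) where
  open Rotation ρ

  -- `to-next` records `prev s ∉ S` because this is what rules out a collision with a charge of the
  -- other kind. That `t` lies outside `S` is recorded in `Chargeable`.
  data Charge (s t : Fin n) : Set where
    to-opposite : t ≡ opposite s → Charge s t
    to-next     : t ≡ next s → prev s ∉ S → Charge s t

  opposite≡next⇒prev∈ : ∀ {s s′} → s ∈ S → opposite s ≡ next s′ → prev s′ ∈ S
  opposite≡next⇒prev∈ {s} s∈S eq =
    subst (_∈ S) (trans (sym (opposite-involutive s)) (cong opposite eq)) s∈S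

  -- Charges of the same kind are separated by injectivity of `next`. In a mixed collision
  -- `opposite s ≡ next s′`, applying `opposite` gives `s ≡ prev s′`, so `prev s′` would lie in `S`.
  charge-injective : ∀ {s s′ t} → s ∈ S → s′ ∈ S → Charge s t → Charge s′ t → s ≡ s′
  charge-injective _   _    (to-opposite refl) (to-opposite eq) = next-injective (next-injective eq)
  charge-injective _   _    (to-next refl _)   (to-next eq _)   = next-injective eq
  charge-injective s∈S _    (to-opposite refl) (to-next eq p∉S) =
    contradiction (opposite≡next⇒prev∈ s∈S eq) p∉S
  charge-injective _   s′∈S (to-next refl p∉S) (to-opposite eq) =
    contradiction (opposite≡next⇒prev∈ s′∈S (sym eq)) p∉S

  Chargeable : Fin n → Set
  Chargeable s = ∃ λ t → t ∈ ∁ S × Charge s t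

  -- The neighbour in `S` will dominate `s` once `s` is deleted; `opposite s` will take over the
  -- neighbours of `s`.
  Removable : Fin n → Set
  Removable s = opposite s ∈ S × ∃ λ u → u ∈ S × Adj G s u

  chargeable? : ∀ s → Chargeable s ⊎ Removable s
  chargeable? s with opposite s ∈? S | next s ∈? S | prev s ∈? S
  ... | no  o∉S | _       | _       = inj₁ (_ , x∉p⇒x∈∁p o∉S , to-opposite refl)
  ... | yes o∈S | yes x∈S | _       = inj₂ (o∈S , _ , x∈S , adj-next s)
  ... | yes o∈S | no  _   | yes p∈S = inj₂ (o∈S , _ , p∈S , adj-prev s)
  -- Both neighbours of `s` lie outside `S`, so `next s` can receive the charge.
  ... | yes _   | no  x∉S | no  p∉S = inj₁ (_ , x∉p⇒x∈∁p x∉S , to-next refl p∉S)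

∃⊎∀ : {P Q : Fin k → Set} → (∀ i → P i ⊎ Q i) → ∃ P ⊎ (∀ i → Q i)
∃⊎∀ {zero}  f = inj₂ λ ()
∃⊎∀ {suc k} f with f zero | ∃⊎∀ (λ i → f (suc i))
... | inj₁ p | _            = inj₁ (zero , p)
... | inj₂ _ | inj₁ (i , p) = inj₁ (suc i , p)
... | inj₂ q | inj₂ qs      = inj₂ λ { zero → q ; (suc i) → qs i }

module _ {F : Fin k → Graph (Fin n)} (ρ : ∀ i → Rotation (F i)) {S : Subset n}
         (dominates : SimultaneouslyDominates F S) where

  removable⇒dominates : ∀ {s} → (∀ i → Removable (ρ i) S s) → SimultaneouslyDominates F (S - s)
  removable⇒dominates {s} removable i v v∉S-s with v Fin.≟ s
  ... | yes refl with removable i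
  -- The deleted vertex itself: its neighbour `u` differs from it, as there are no loops.
  ...   | _ , u , u∈S , a = u , x∈p∧x≢y⇒x∈p-y u∈S (λ u≡s → irrefl (F i) (sym u≡s) a) , a
  removable⇒dominates {s} removable i v v∉S-s | no v≢s
    with dominates i v (λ v∈S → v∉S-s (x∈p∧x≢y⇒x∈p-y v∈S v≢s))
  ... | u , u∈S , a with u Fin.≟ s
  ...   | no u≢s   = u , x∈p∧x≢y⇒x∈p-y u∈S u≢s , a
  ...   | yes refl with removable i
  -- The old dominator of `v` was the deleted vertex; its opposite has the same neighbours and is
  -- still present.
  ...     | o∈S , _ = opposite u , x∈p∧x≢y⇒x∈p-y o∈S (opposite-≢ u) , adj-opposite a
    where open Rotation (ρ i)

  module _ (least : ∀ S′ → SimultaneouslyDominates F S′ → ∣ S ∣ ≤ ∣ S′ ∣) where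

    -- If every factor allowed the removal of `s`, then `S - s` would be a smaller simultaneous
    -- dominating set.
    some-chargeable : ∀ {s} → s ∈ S → ∃ λ i → Chargeable (ρ i) S s
    some-chargeable {s} s∈S with ∃⊎∀ (λ i → chargeable? (ρ i) S s)
    ... | inj₁ c = c
    ... | inj₂ r = contradiction (least (S - s) (removable⇒dominates r)) (<⇒≱ (x∈p⇒∣p-x∣<∣p∣ s∈S))

    ∣S∣≤k*∣∁S∣ : ∣ S ∣ ≤ k * ∣ ∁ S ∣
    ∣S∣≤k*∣∁S∣ = ∣p∣≤k*∣q∣-by-matchings (λ i → Charge (ρ i) S) S (∁ S)
      some-chargeable (λ i → charge-injective (ρ i) S)

    [1+k]*∣S∣≤k*n : suc k * ∣ S ∣ ≤ k * n
    [1+k]*∣S∣≤k*n = begin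
      ∣ S ∣ + k * ∣ S ∣       ≤⟨ +-monoˡ-≤ (k * ∣ S ∣) ∣S∣≤k*∣∁S∣ ⟩
      k * ∣ ∁ S ∣ + k * ∣ S ∣ ≡⟨ *-distribˡ-+ k ∣ ∁ S ∣ ∣ S ∣ ⟨
      k * (∣ ∁ S ∣ + ∣ S ∣)   ≡⟨ cong (λ c → k * (c + ∣ S ∣)) (∣∁p∣≡n∸∣p∣ S) ⟩
      k * (n ∸ ∣ S ∣ + ∣ S ∣) ≡⟨ cong (k *_) (m∸n+n≡m (∣p∣≤n S)) ⟩
      k * n                   ∎
      where open ≤-Reasoning

-- The bound for any number `k` of factors; the 4-cycles enter only through their rotations.
[1+k]*γsd≤k*n : (F : Fin k → Graph (Fin n)) → (∀ i → Rotation (F i)) → suc k * γsd F ≤ k * n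
[1+k]*γsd≤k*n F ρ with sdNumber F
... | _ , (S , dominates , refl) , least =
  -- Minimality among attained cardinalities is turned into minimality among dominating sets.
  [1+k]*∣S∣≤k*n ρ dominates λ S′ dominates′ → least ∣ S′ ∣ (S′ , dominates′ , refl)

theorem25 : (n : ℕ) → 0 < n → n % 4 ≡ 0 →
    (F : Fin 3 → Graph (Fin n)) →
    (∀ i → F i ≅ copies (n / 4) C₄) →
    γsd F ≤ 3 * n / 4
theorem25 n _ _ F F≅ = begin
  γsd F         ≡⟨ m*n/n≡m (γsd F) 4 ⟨
  γsd F * 4 / 4 ≡⟨ cong (_/ 4) (*-comm (γsd F) 4) ⟩
  -- The case `k = 3`. Division rounds down but is monotone, and on the left it is exact.
  4 * γsd F / 4 ≤⟨ /-monoˡ-≤ 4 ([1+k]*γsd≤k*n F λ i → ≅-rotation (F≅ i) (copies-rotation C₄-rotation)) ⟩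
  3 * n / 4     ∎
  where open ≤-Reasoning
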